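{- Let $k \ge 1$ be an integer and let $\mu \in [0,k]$ be a real number. Then $\operatorname{opt}(\mathrm{LP}(k,\mu)) = \operatorname{opt}(\mathrm{IP}(k,\mu))$, where $\operatorname{opt}(\mathrm{LP}(k,\mu))$ is the max-knapsack-profit of the harmonic function $f_k$ and $\operatorname{opt}(\mathrm{IP}(k,\mu))$ is the optimal value of the integer program $$\max_{z \in \mathbb{Z}_{\ge 0}^{k-1}} \ \mu + \sum_{j=1}^{k-1} z_j\left(\frac{1}{j} - \frac{\mu}{j+1}\right) \quad \text{subject to} \quad \sum_{j=1}^{k-1} \frac{z_j}{j+1} < 1.$$
   Context: For an integer $k\ge 1$ and real $\mu\in[0,k]$, the harmonic function $f_k:[0,1]\to[0,1]$ is defined by $f_k(x) = 1/j$ if $x \in \left(\frac{1}{j+1}, \frac1j\right]$ for some $j \in \{1,\dots,k-1\}$, and $f_k(x) = \mu x$ if $x \in [0, 1/k]$. For a finite sequence $X = [x_1,\dots,x_n]$ write $\operatorname{sum}(X) = \sum_i x_i$ and $f_k(X) = [f_k(x_1),\dots,f_k(x_n)]$. Define $$\operatorname{opt}(\mathrm{LP}(k,\mu)) = \sup_{n>0}\ \sup\{\operatorname{sum}(f_k(X)) : X \in \mathbb{R}_{\ge 0}^n,\ \operatorname{sum}(X) \le 1\}.$$ -}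

module Defs where

open import Level using (Level; _⊔_) renaming (suc to lsuc)
open import Algebra.Bundles using (CommutativeRing)
import Algebra.Definitions.RawMonoid as RawMonoidDefs
open import Algebra.Core using (Op₁)
open import Data.Fin.Base using (Fin; toℕ)
open import Data.Fin.Properties using (any?)
open import Data.Nat.Base using (ℕ; suc; pred; NonZero)
open import Data.Product.Base using (_×_; _,_; ∃; ∃-syntax; Σ-syntax)
open import Data.Vec.Functional using (Vector; map)
open import Relation.Binary.Core using (Rel)
open import Relation.Binary.Structures using (IsDecTotalOrder)
import Relation.Binary.Construct.NonStrictToStrict as NonStrictToStrict
open import Relation.Nullary.Decidable using (Dec; yes; no; _×-dec_)
open import Relation.Unary using (Pred)

module Bounds {a ℓ} {A : Set a} (_≤_ : Rel A ℓ) where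

  IsUpperBound : ∀ {p} → Pred A p → Pred A (a ⊔ ℓ ⊔ p)
  IsUpperBound S u = ∀ s → S s → s ≤ u

  IsSupremum : ∀ {p} → Pred A p → Pred A (a ⊔ ℓ ⊔ p)
  IsSupremum S v = IsUpperBound S v × (∀ u → IsUpperBound S u → v ≤ u)

  IsMaximum : ∀ {p} → Pred A p → Pred A (a ⊔ ℓ ⊔ p)
  IsMaximum S v = S v × IsUpperBound S v

-- The real numbers of classical mathematics, presented axiomatically as a
-- Dedekind-complete ordered field.  Decidability of the order is the part of
-- classical logic that makes discontinuous, piecewise-defined functions total.

record RealField (c ℓ₁ ℓ₂ : Level) : Set (lsuc (c ⊔ ℓ₁ ⊔ ℓ₂)) where
  infix  4 _≤_ _<?_
  infix  8 _⁻¹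
  infix  9 1/_
  field
    commutativeRing : CommutativeRing c ℓ₁

  open CommutativeRing commutativeRing public
    hiding (refl; sym; trans; reflexive)

  field
    _≤_             : Rel Carrier ℓ₂
    isDecTotalOrder : IsDecTotalOrder _≈_ _≤_
    +-monoʳ-≤       : ∀ x {y z} → y ≤ z → x + y ≤ x + z
    *-nonNegative   : ∀ {x y} → 0# ≤ x → 0# ≤ y → 0# ≤ x * y
    0≉1             : 0# ≉ 1#
    -- The value of 0# ⁻¹ is unspecified.
    _⁻¹             : Op₁ Carrier
    *-inverseʳ      : ∀ {x} → x ≉ 0# → x * x ⁻¹ ≈ 1#

  open Bounds _≤_ public

  field
    complete : (S : Pred Carrier (c ⊔ ℓ₁ ⊔ ℓ₂)) →
               ∃ S → ∃ (IsUpperBound S) → ∃ (IsSupremum S)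

  open IsDecTotalOrder isDecTotalOrder public
    using (_≟_; _≤?_)
    renaming (module Eq to ≈; refl to ≤-refl; reflexive to ≤-reflexive;
              trans to ≤-trans; antisym to ≤-antisym; total to ≤-total)

  open NonStrictToStrict _≈_ _≤_ public using (_<_)

  _<?_ : ∀ x y → Dec (x < y)
  _<?_ = NonStrictToStrict.<-decidable _≈_ _≤_ _≟_ _≤?_

  open RawMonoidDefs +-rawMonoid public using (sum) renaming (_×_ to _·_)

  fromℕ : ℕ → Carrier
  fromℕ n = n · 1#

  1/_ : ℕ → Carrier
  1/ n = fromℕ n ⁻¹

module Harmonic {c ℓ₁ ℓ₂} (R : RealField c ℓ₁ ℓ₂) where
  open RealField R

  -- The indices 1, …, k - 1 are represented by Fin (pred k), shifted by one.
  index : ∀ {m} → Fin m → ℕ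
  index i = suc (toℕ i)

  InInterval : ℕ → Carrier → Set (ℓ₁ ⊔ ℓ₂)
  InInterval j x = 1/ (suc j) < x × x ≤ 1/ j

  inInterval? : ∀ j x → Dec (InInterval j x)
  inInterval? j x = (1/ (suc j) <? x) ×-dec (x ≤? 1/ j)

  -- f_k.  The last clause only concerns arguments outside [0,1], which is not
  -- part of the domain of f_k.
  f : ℕ → Carrier → Carrier → Carrier
  f k μ x with any? {n = pred k} (λ i → inInterval? (index i) x)
  ... | yes (i , _) = 1/ (index i)
  ... | no _ with (0# ≤? x) ×-dec (x ≤? 1/ k)
  ...   | yes _ = μ * x
  ...   | no _  = 0#

  FeasibleLP : ∀ {n} → Vector Carrier n → Set ℓ₂
  FeasibleLP X = (∀ i → 0# ≤ X i) × sum X ≤ 1#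

  LPValue : ℕ → Carrier → ℕ → Pred Carrier (c ⊔ ℓ₁ ⊔ ℓ₂)
  LPValue k μ n s =
    Σ[ X ∈ Vector Carrier n ] FeasibleLP X × s ≈ sum (map (f k μ) X)

  -- The iterated supremum sup_{n>0} sup_X.
  IsOptLP : ℕ → Carrier → Pred Carrier (c ⊔ ℓ₁ ⊔ ℓ₂)
  IsOptLP k μ =
    IsSupremum (λ s → ∃[ n ] NonZero n × IsSupremum (LPValue k μ n) s)

  FeasibleIP : ∀ k → Vector ℕ (pred k) → Set (ℓ₁ ⊔ ℓ₂)
  FeasibleIP k z = sum (λ i → fromℕ (z i) * 1/ (suc (index i))) < 1#

  objectiveIP : ∀ k → Carrier → Vector ℕ (pred k) → Carrier
  objectiveIP k μ z =
    μ + sum (λ i → fromℕ (z i) * (1/ (index i) - μ * 1/ (suc (index i))))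

  IPValue : ℕ → Carrier → Pred Carrier (ℓ₁ ⊔ ℓ₂)
  IPValue k μ s = Σ[ z ∈ Vector ℕ (pred k) ] FeasibleIP k z × s ≈ objectiveIP k μ z

  IsOptIP : ℕ → Carrier → Pred Carrier (c ⊔ ℓ₁ ⊔ ℓ₂)
  IsOptIP k μ = IsMaximum (IPValue k μ)

{-# OPTIONS --safe #-}
module Submission where

-- Round every item of (1/(j+1), 1/j] down to 1/(j+1), keeping its profit 1/j, and
-- count the items of each interval: the counts z are feasible for the integer
-- program, the inequality being strict because each rounding is.  The remaining
-- items earn at most μ per unit of size, so if the rounded items have total size A
-- the profit is at most Σ z_j/j + μ (1 - A), which is the integer objective.
-- Conversely, take z_j items of size 1/(j+1) + δ and fill the rest of the knapsack
-- with k equal items, which are then at most 1/k.  Their total profit is the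
-- integer objective minus μδ Σ z_j, and δ may be arbitrarily small.

open import Defs
open import Data.Nat.Base using (ℕ; NonZero)
open import Data.Product.Base using (_×_; ∃-syntax)
open import Algebra.Bundles using (CommutativeMonoid; CommutativeRing)
import Algebra.Properties.CommutativeSemigroup as CommutativeSemigroupProperties
import Algebra.Properties.Group as GroupProperties
import Algebra.Properties.CommutativeMonoid.Sum as CMSumProperties
import Algebra.Properties.Ring as RingProperties
import Algebra.Properties.Semiring.Sum as SumProperties
open import Data.Fin.Base using (Fin; zero; suc; toℕ; fromℕ<; funToFin; finToFun)
open import Data.Fin.Properties using (any?; toℕ-fromℕ<; toℕ<n; finToFun-funToFin)
open import Data.List.Base as List using (List; allFin; filter)
import Data.List.Extrema as Extrema
open import Data.List.Membership.Propositional.Properties using (∈-allFin; ∈-map⁺; ∈-filter⁺)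
import Data.List.Relation.Unary.All as All
open import Data.List.Relation.Unary.All.Properties using (all-filter)
open import Data.Maybe.Base using (nothing)
open import Data.Nat.Base as ℕ using (zero; suc; z≤n; s≤s)
import Data.Nat.Properties as ℕ
open import Data.Product.Base using (_,_; ∃; proj₁; proj₂)
open import Data.Sum.Base using (_⊎_; inj₁; inj₂)
open import Data.Vec.Functional using (Vector; map; updateAt)
open import Function.Base using (_∘_)
open import Level using (_⊔_)
open import Relation.Binary.Bundles using (DecTotalOrder)
open import Relation.Binary.PropositionalEquality as ≡ using (_≗_)
import Relation.Binary.Reasoning.PartialOrder as ≤-ReasoningOn
open import Relation.Binary.Definitions using (_Respects_)
open import Relation.Nullary.Decidable using (yes; no; _×-dec_; decidable-stable)
open import Relation.Nullary.Negation using (¬_; contradiction)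
open import Relation.Unary using (Pred; Decidable)
open import Tactic.RingSolver using (solve-∀)
open import Tactic.RingSolver.Core.AlmostCommutativeRing using (fromCommutativeRing; AlmostCommutativeRing)

-- Ring identities for the profit accounting.

module RingIdentities {c ℓ} (R : CommutativeRing c ℓ) where
  acr : AlmostCommutativeRing c ℓ
  acr = fromCommutativeRing R (λ _ → nothing)

  open AlmostCommutativeRing acr

  regroup-small : ∀ μ x s d → μ * x + (μ * s + d) ≈ μ * (x + s) + d
  regroup-small = solve-∀ acr

  regroup-large : ∀ g μ x s d → g + μ * x + (μ * s + d) ≈ μ * (x + s) + (g + d)
  regroup-large = solve-∀ acr

  regroup-perturbed : ∀ μ A δ N r G → μ * (A + δ * N + r) + G ≈ μ * N * δ + (G + μ * A + μ * r)
  regroup-perturbed = solve-∀ acr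

-- Arithmetic of an ordered field.

module OrderedField {c ℓ₁ ℓ₂} (R : RealField c ℓ₁ ℓ₂) where
  open RealField R hiding (zero)
  open GroupProperties +-group public using (//-rightDividesˡ)
  open GroupProperties +-group using (∙-cancelˡ; ⁻¹-involutive)
  open RingProperties ring using (-1*x≈-x)
  open CommutativeSemigroupProperties *-commutativeSemigroup public
    using () renaming (x∙yz≈y∙xz to x*[y*z]≈y*[x*z])
  open CommutativeSemigroupProperties (CommutativeMonoid.commutativeSemigroup +-commutativeMonoid)
    using () renaming (x∙yz≈y∙xz to x+[y+z]≈y+[x+z])
  open SumProperties semiring using (*-distribˡ-sum)
  open CMSumProperties +-commutativeMonoid using (sum-cong-≋; ∑-distrib-+)

  decTotalOrder : DecTotalOrder c ℓ₁ ℓ₂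
  decTotalOrder = record { isDecTotalOrder = isDecTotalOrder }

  open DecTotalOrder decTotalOrder public using (poset; totalOrder)
  open ≤-ReasoningOn poset public

  -- Peels off one copy of `x`: `fromℕ (suc n)` unfolds to `1# + fromℕ n`. It serves both for
  -- incremented counts and for repeated items.
  [1+n]*x+s≈x+[n*x+s] : ∀ x n s → (1# + n) * x + s ≈ x + (n * x + s)
  [1+n]*x+s≈x+[n*x+s] x n s = begin-equality
    (1# + n) * x + s     ≈⟨ +-congʳ (distribʳ x 1# n) ⟩
    1# * x + n * x + s   ≈⟨ +-congʳ (+-congʳ (*-identityˡ x)) ⟩
    x + n * x + s        ≈⟨ +-assoc x (n * x) s ⟩
    x + (n * x + s)      ∎

  <⇒≤ : ∀ {x y} → x < y → x ≤ y
  <⇒≤ = proj₁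

  <⇒≱ : ∀ {x y} → x < y → ¬ y ≤ x
  <⇒≱ (x≤y , x≉y) y≤x = x≉y (≤-antisym x≤y y≤x)

  ≰⇒> : ∀ {x y} → ¬ x ≤ y → y < x
  ≰⇒> {x} {y} x≰y with ≤-total x y
  ... | inj₁ x≤y = contradiction x≤y x≰y
  ... | inj₂ y≤x = y≤x , λ y≈x → x≰y (≤-reflexive (≈.sym y≈x))

  +-mono-≤ : ∀ {x y u v} → x ≤ y → u ≤ v → x + u ≤ y + v
  +-mono-≤ {x} {y} {u} {v} x≤y u≤v = begin
    x + u ≤⟨ +-monoʳ-≤ x u≤v ⟩
    x + v ≈⟨ +-comm x v ⟩
    v + x ≤⟨ +-monoʳ-≤ v x≤y ⟩
    v + y ≈⟨ +-comm v y ⟩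
    y + v ∎

  +-monoʳ-< : ∀ x {y z} → y < z → x + y < x + z
  +-monoʳ-< x (y≤z , y≉z) = +-monoʳ-≤ x y≤z , y≉z ∘ ∙-cancelˡ x _ _

  +-mono-<-≤ : ∀ {x y u v} → x < y → u ≤ v → x + u < y + v
  +-mono-<-≤ {x} {y} {u} {v} x<y u≤v = begin-strict
    x + u ≤⟨ +-monoʳ-≤ x u≤v ⟩
    x + v ≈⟨ +-comm x v ⟩
    v + x <⟨ +-monoʳ-< v x<y ⟩
    v + y ≈⟨ +-comm v y ⟩
    y + v ∎

  +-nonNegative : ∀ {x y} → 0# ≤ x → 0# ≤ y → 0# ≤ x + y
  +-nonNegative {x} {y} 0≤x 0≤y = begin
    0#      ≈⟨ +-identityˡ 0# ⟨
    0# + 0# ≤⟨ +-mono-≤ 0≤x 0≤y ⟩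
    x + y   ∎

  x≤x+y : ∀ x {y} → 0# ≤ y → x ≤ x + y
  x≤x+y x {y} 0≤y = begin
    x      ≈⟨ +-identityʳ x ⟨
    x + 0# ≤⟨ +-monoʳ-≤ x 0≤y ⟩
    x + y  ∎

  y≤x+y : ∀ {x} y → 0# ≤ x → y ≤ x + y
  y≤x+y y 0≤x = ≤-trans (x≤x+y y 0≤x) (≤-reflexive (+-comm _ _))

  x<x+y : ∀ x {y} → 0# < y → x < x + y
  x<x+y x {y} 0<y = begin-strict
    x      ≈⟨ +-identityʳ x ⟨
    x + 0# <⟨ +-monoʳ-< x 0<y ⟩
    x + y  ∎

  x+[y-x]≈y : ∀ x y → x + (y - x) ≈ y
  x+[y-x]≈y x y = ≈.trans (+-comm _ _) (//-rightDividesˡ x y)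

  x≤y⇒0≤y-x : ∀ {x y} → x ≤ y → 0# ≤ y - x
  x≤y⇒0≤y-x {x} {y} x≤y = begin
    0#       ≈⟨ -‿inverseˡ x ⟨
    - x + x  ≤⟨ +-monoʳ-≤ (- x) x≤y ⟩
    - x + y  ≈⟨ +-comm _ _ ⟩
    y - x    ∎

  x<y⇒0<y-x : ∀ {x y} → x < y → 0# < y - x
  x<y⇒0<y-x {x} {y} x<y = begin-strict
    0#       ≈⟨ -‿inverseˡ x ⟨
    - x + x  <⟨ +-monoʳ-< (- x) x<y ⟩
    - x + y  ≈⟨ +-comm _ _ ⟩
    y - x    ∎

  *-monoʳ-≤ : ∀ {x y z} → 0# ≤ x → y ≤ z → x * y ≤ x * z
  *-monoʳ-≤ {x} {y} {z} 0≤x y≤z = begin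
    x * y               ≤⟨ x≤x+y _ (*-nonNegative 0≤x (x≤y⇒0≤y-x y≤z)) ⟩
    x * y + x * (z - y) ≈⟨ distribˡ x y (z - y) ⟨
    x * (y + (z - y))   ≈⟨ *-congˡ (x+[y-x]≈y y z) ⟩
    x * z               ∎

  *-monoˡ-≤ : ∀ {x y z} → 0# ≤ x → y ≤ z → y * x ≤ z * x
  *-monoˡ-≤ {x} {y} {z} 0≤x y≤z = begin
    y * x ≈⟨ *-comm y x ⟩
    x * y ≤⟨ *-monoʳ-≤ 0≤x y≤z ⟩
    x * z ≈⟨ *-comm x z ⟩
    z * x ∎

  -- If `1# ≤ 0#`, then `- 1#` is nonnegative, and so is its square `1#`.
  0<1 : 0# < 1#
  0<1 with ≤-total 0# 1#
  ... | inj₁ 0≤1 = 0≤1 , 0≉1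
  ... | inj₂ 1≤0 = 0≤1 , 0≉1
    where
    0≤-1 : 0# ≤ - 1#
    0≤-1 = ≤-trans (x≤y⇒0≤y-x 1≤0) (≤-reflexive (+-identityˡ (- 1#)))

    0≤1 : 0# ≤ 1#
    0≤1 = begin
      0#          ≤⟨ *-nonNegative 0≤-1 0≤-1 ⟩
      - 1# * - 1# ≈⟨ -1*x≈-x (- 1#) ⟩
      - (- 1#)    ≈⟨ ⁻¹-involutive 1# ⟩
      1#          ∎

  0≤fromℕ : ∀ n → 0# ≤ fromℕ n
  0≤fromℕ zero    = ≤-refl
  0≤fromℕ (suc n) = +-nonNegative (<⇒≤ 0<1) (0≤fromℕ n)

  0<1+x : ∀ {x} → 0# ≤ x → 0# < 1# + x
  0<1+x {x} 0≤x = begin-strict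
    0#      <⟨ 0<1 ⟩
    1#      ≤⟨ x≤x+y 1# 0≤x ⟩
    1# + x  ∎

  fromℕ-mono-≤ : ∀ {m n} → m ℕ.≤ n → fromℕ m ≤ fromℕ n
  fromℕ-mono-≤ {n = n} z≤n       = 0≤fromℕ n
  fromℕ-mono-≤         (s≤s m≤n) = +-monoʳ-≤ 1# (fromℕ-mono-≤ m≤n)

  *-inverse : ∀ {x} → 0# < x → x * x ⁻¹ ≈ 1#
  *-inverse (_ , 0≉x) = *-inverseʳ (0≉x ∘ ≈.sym)

  ⁻¹-positive : ∀ {x} → 0# < x → 0# < x ⁻¹
  ⁻¹-positive {x} 0<x = ≰⇒> λ x⁻¹≤0 → <⇒≱ 0<1 (begin
    1#       ≈⟨ *-inverse 0<x ⟨
    x * x ⁻¹ ≤⟨ *-monoʳ-≤ (<⇒≤ 0<x) x⁻¹≤0 ⟩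
    x * 0#   ≈⟨ zeroʳ x ⟩
    0#       ∎)

  *-positive : ∀ {x y} → 0# < x → 0# < y → 0# < x * y
  *-positive {x} {y} 0<x 0<y = *-nonNegative (<⇒≤ 0<x) (<⇒≤ 0<y) , λ 0≈xy → proj₂ 0<x (begin-equality
    0#              ≈⟨ zeroˡ (y ⁻¹) ⟨
    0# * y ⁻¹       ≈⟨ *-congʳ 0≈xy ⟩
    x * y * y ⁻¹    ≈⟨ *-assoc x y (y ⁻¹) ⟩
    x * (y * y ⁻¹)  ≈⟨ *-congˡ (*-inverse 0<y) ⟩
    x * 1#          ≈⟨ *-identityʳ x ⟩
    x               ∎)

  ⁻¹-anti-≤ : ∀ {x y} → 0# < x → x ≤ y → y ⁻¹ ≤ x ⁻¹
  ⁻¹-anti-≤ {x} {y} 0<x x≤y = begin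
    y ⁻¹              ≈⟨ *-identityʳ (y ⁻¹) ⟨
    y ⁻¹ * 1#         ≈⟨ *-congˡ (*-inverse 0<x) ⟨
    y ⁻¹ * (x * x ⁻¹) ≤⟨ *-monoʳ-≤ (<⇒≤ (⁻¹-positive 0<y)) (*-monoˡ-≤ (<⇒≤ (⁻¹-positive 0<x)) x≤y) ⟩
    y ⁻¹ * (y * x ⁻¹) ≈⟨ *-assoc (y ⁻¹) y (x ⁻¹) ⟨
    y ⁻¹ * y * x ⁻¹   ≈⟨ *-congʳ (*-comm (y ⁻¹) y) ⟩
    y * y ⁻¹ * x ⁻¹   ≈⟨ *-congʳ (*-inverse 0<y) ⟩
    1# * x ⁻¹         ≈⟨ *-identityˡ (x ⁻¹) ⟩
    x ⁻¹              ∎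
    where
    0<y : 0# < y
    0<y = begin-strict 0# <⟨ 0<x ⟩ x ≤⟨ x≤y ⟩ y ∎

  ⁻¹-anti-< : ∀ {x y} → 0# < x → x < y → y ⁻¹ < x ⁻¹
  ⁻¹-anti-< {x} {y} 0<x x<y = ⁻¹-anti-≤ 0<x (<⇒≤ x<y) , λ y⁻¹≈x⁻¹ → proj₂ x<y (begin-equality
    x               ≈⟨ *-identityʳ x ⟨
    x * 1#          ≈⟨ *-congˡ (*-inverse 0<y) ⟨
    x * (y * y ⁻¹)  ≈⟨ *-congˡ (*-congˡ y⁻¹≈x⁻¹) ⟩
    x * (y * x ⁻¹)  ≈⟨ x*[y*z]≈y*[x*z] x y (x ⁻¹) ⟩
    y * (x * x ⁻¹)  ≈⟨ *-congˡ (*-inverse 0<x) ⟩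
    y * 1#          ≈⟨ *-identityʳ y ⟩
    y               ∎)
    where
    0<y : 0# < y
    0<y = begin-strict 0# <⟨ 0<x ⟩ x <⟨ x<y ⟩ y ∎

  -- Reciprocals of positive integers.

  0<fromℕ : ∀ n .{{_ : NonZero n}} → 0# < fromℕ n
  0<fromℕ (suc n) = 0<1+x (0≤fromℕ n)

  0<1/ : ∀ n .{{_ : NonZero n}} → 0# < 1/ n
  0<1/ n = ⁻¹-positive (0<fromℕ n)

  1/-anti-≤ : ∀ {m n} .{{_ : NonZero m}} → m ℕ.≤ n → 1/ n ≤ 1/ m
  1/-anti-≤ {m} m≤n = ⁻¹-anti-≤ (0<fromℕ m) (fromℕ-mono-≤ m≤n)

  1/-suc-< : ∀ n .{{_ : NonZero n}} → 1/ (suc n) < 1/ n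
  1/-suc-< n = ⁻¹-anti-< (0<fromℕ n) (begin-strict
    fromℕ n       <⟨ x<x+y (fromℕ n) 0<1 ⟩
    fromℕ n + 1#  ≈⟨ +-comm (fromℕ n) 1# ⟩
    fromℕ (suc n) ∎)

  fromℕ-*-1/ : ∀ n .{{_ : NonZero n}} → fromℕ n * 1/ n ≈ 1#
  fromℕ-*-1/ n = *-inverse (0<fromℕ n)

  -- Nonnegative sums and small positive quantities.

  sum-nonNegative : ∀ {n} (X : Vector Carrier n) → (∀ i → 0# ≤ X i) → 0# ≤ sum X
  sum-nonNegative {zero}  X 0≤X = ≤-refl
  sum-nonNegative {suc n} X 0≤X = +-nonNegative (0≤X zero) (sum-nonNegative (X ∘ suc) (0≤X ∘ suc))

  term≤sum : ∀ {n} (X : Vector Carrier n) → (∀ i → 0# ≤ X i) → ∀ i → X i ≤ sum X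
  term≤sum X 0≤X zero    = x≤x+y (X zero) (sum-nonNegative (X ∘ suc) (0≤X ∘ suc))
  term≤sum X 0≤X (suc i) = ≤-trans (term≤sum (X ∘ suc) (0≤X ∘ suc) i) (y≤x+y _ (0≤X zero))

  lowerBound : ∀ {n} (X : Vector Carrier n) → (∀ i → 0# < X i) → ∃[ δ ] 0# < δ × (∀ i → δ ≤ X i)
  -- Any positive value serves for the empty vector, which occurs when `k` is 1 and there are no
  -- intervals.
  lowerBound {zero}  X 0<X = 1# , 0<1 , λ ()
  lowerBound {suc n} X 0<X with lowerBound (X ∘ suc) (0<X ∘ suc)
  ... | δ , 0<δ , δ≤X with ≤-total δ (X zero)
  ...   | inj₁ δ≤x = δ , 0<δ , λ { zero → δ≤x ; (suc i) → δ≤X i }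
  ...   | inj₂ x≤δ = X zero , 0<X zero , λ { zero → ≤-refl ; (suc i) → ≤-trans x≤δ (δ≤X i) }

  module _ {x ε} (0≤x : 0# ≤ x) (0<ε : 0# < ε) where

    private
      -- Chosen so that `(1# + x) * η ≈ ε`. Dividing by `1# + x` instead of `x` allows `x ≈ 0#`, and
      -- the surplus `y` in `(1# + x) * y` makes the bound on `x * y` strict.
      η : Carrier
      η = ε * (1# + x) ⁻¹

      0<η : 0# < η
      0<η = *-positive 0<ε (⁻¹-positive (0<1+x 0≤x))

      x*y<ε : ∀ {y} → 0# < y → y ≤ η → x * y < ε
      x*y<ε {y} 0<y y≤η = begin-strict
        x * y                         <⟨ x<x+y (x * y) 0<y ⟩
        x * y + y                     ≈⟨ +-congˡ (*-identityˡ y) ⟨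
        x * y + 1# * y                ≈⟨ distribʳ y x 1# ⟨
        (x + 1#) * y                  ≈⟨ *-congʳ (+-comm x 1#) ⟩
        (1# + x) * y                  ≤⟨ *-monoʳ-≤ (<⇒≤ (0<1+x 0≤x)) y≤η ⟩
        (1# + x) * (ε * (1# + x) ⁻¹)  ≈⟨ x*[y*z]≈y*[x*z] (1# + x) ε _ ⟩
        ε * ((1# + x) * (1# + x) ⁻¹)  ≈⟨ *-congˡ (*-inverse (0<1+x 0≤x)) ⟩
        ε * 1#                        ≈⟨ *-identityʳ ε ⟩
        ε                             ∎

    -- The smaller of `δ` and `η`. Since the result never exceeds `δ`, several smallness conditions
    -- can be imposed one after another.
    shrink : ∀ {δ} → 0# < δ → ∃[ δ′ ] 0# < δ′ × δ′ ≤ δ × x * δ′ < ε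
    shrink {δ} 0<δ with ≤-total δ η
    ... | inj₁ δ≤η = δ , 0<δ , ≤-refl , x*y<ε 0<δ δ≤η
    ... | inj₂ η≤δ = η , 0<η , η≤δ , x*y<ε 0<η ≤-refl

  -- Weighted counts, which unfold to the sums in `FeasibleIP` and `objectiveIP`.

  dot : ∀ {n} → Vector ℕ n → Vector Carrier n → Carrier
  dot z w = sum (λ i → fromℕ (z i) * w i)

  dot-congʳ : ∀ {n} (z : Vector ℕ n) {v w} → (∀ i → v i ≈ w i) → dot z v ≈ dot z w
  dot-congʳ z v≈w = sum-cong-≋ (λ i → *-congˡ (v≈w i))

  dot-congˡ : ∀ {n} {y z : Vector ℕ n} → y ≗ z → ∀ w → dot y w ≈ dot z w
  dot-congˡ y≗z w = sum-cong-≋ (λ i → *-congʳ (≈.reflexive (≡.cong fromℕ (y≗z i))))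

  dot-0 : ∀ {n} (w : Vector Carrier n) → dot (λ _ → 0) w ≈ 0#
  dot-0 {zero}  w = ≈.refl
  dot-0 {suc n} w = begin-equality
    0# * w zero + dot (λ _ → 0) (w ∘ suc) ≈⟨ +-cong (zeroˡ (w zero)) (dot-0 (w ∘ suc)) ⟩
    0# + 0#                               ≈⟨ +-identityˡ 0# ⟩
    0#                                    ∎

  dot-linear : ∀ {n} (z : Vector ℕ n) v x w → dot z (λ i → v i + x * w i) ≈ dot z v + x * dot z w
  dot-linear z v x w = begin-equality
    dot z (λ i → v i + x * w i)
      ≈⟨ sum-cong-≋ {x = λ i → fromℕ (z i) * (v i + x * w i)}
           (λ i → ≈.trans (distribˡ _ _ _) (+-congˡ (x*[y*z]≈y*[x*z] _ _ _))) ⟩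
    sum (λ i → fromℕ (z i) * v i + x * (fromℕ (z i) * w i))
      ≈⟨ ∑-distrib-+ (λ i → fromℕ (z i) * v i) (λ i → x * (fromℕ (z i) * w i)) ⟩
    dot z v + sum (λ i → x * (fromℕ (z i) * w i))
      ≈⟨ +-congˡ (*-distribˡ-sum x (λ i → fromℕ (z i) * w i)) ⟨
    dot z v + x * dot z w ∎

  dot-increment : ∀ {n} (z : Vector ℕ n) i w → dot (updateAt z i suc) w ≈ w i + dot z w
  dot-increment z zero w = [1+n]*x+s≈x+[n*x+s] (w zero) (fromℕ (z zero)) _
  dot-increment z (suc i) w = begin-equality
    x + dot (updateAt (z ∘ suc) i suc) (w ∘ suc) ≈⟨ +-congˡ (dot-increment (z ∘ suc) i (w ∘ suc)) ⟩
    x + (w (suc i) + dot (z ∘ suc) (w ∘ suc))    ≈⟨ x+[y+z]≈y+[x+z] x (w (suc i)) _ ⟩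
    w (suc i) + dot z w                          ∎
    where x = fromℕ (z zero) * w zero

  dot-terms-nonNegative : ∀ {n} (z : Vector ℕ n) (w : Vector Carrier n) → (∀ i → 0# ≤ w i) → ∀ i → 0# ≤ fromℕ (z i) * w i
  dot-terms-nonNegative z w 0≤w i = *-nonNegative (0≤fromℕ (z i)) (0≤w i)

  dot-nonNegative : ∀ {n} (z : Vector ℕ n) (w : Vector Carrier n) → (∀ i → 0# ≤ w i) → 0# ≤ dot z w
  dot-nonNegative z w 0≤w = sum-nonNegative _ (dot-terms-nonNegative z w 0≤w)

  -- Maxima over finitely many integer vectors.

  module _ {m p} (B : ℕ) {P : Pred (Vector ℕ m) p} (P? : Decidable P) (resp : P Respects _≗_)
           (bounded : ∀ z → P z → ∀ i → z i ℕ.< B)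
           (g : Vector ℕ m → Carrier) (g-cong : ∀ {y z} → y ≗ z → g y ≈ g z) where

    private
      -- Vectors with entries below `B` are read as the base-`B` digits of a number below `B ^ m`,
      -- which makes them a finite list.
      decode : Fin (B ℕ.^ m) → Vector ℕ m
      decode e = toℕ ∘ finToFun {B} {m} e

      encode : ∀ z → P z → Fin (B ℕ.^ m)
      encode z Pz = funToFin (λ i → fromℕ< (bounded z Pz i))

      decode-encode : ∀ z Pz → decode (encode z Pz) ≗ z
      decode-encode z Pz i =
        ≡.trans (≡.cong toℕ (finToFun-funToFin (λ i → fromℕ< (bounded z Pz i)) i))
                (toℕ-fromℕ< (bounded z Pz i))

      candidates : List (Vector ℕ m)
      candidates = filter P? (List.map decode (allFin (B ℕ.^ m)))

    -- Each vector in `P` is only pointwise equal to a listed one; `resp` and `g-cong` transfer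
    -- membership and value between the two.
    argmax-exists : ∃ P → ∃[ z ] (P z × ∀ y → P y → g y ≤ g z)
    argmax-exists (z₀ , Pz₀) =
        -- `z₀` is the default of `argmax`, so the result satisfies `P` by `Pz₀` together with the
        -- filter.
        Extrema.argmax totalOrder g z₀ candidates
      , Extrema.argmax-all totalOrder g {P = P} {xs = candidates} Pz₀
          (all-filter P? (List.map decode (allFin (B ℕ.^ m))))
      , λ y Py →
          let ŷ     = decode (encode y Py)
              y≗ŷ   = ≡.sym ∘ decode-encode y Py
              ŷ∈    = ∈-filter⁺ P? (∈-map⁺ decode (∈-allFin (encode y Py))) (resp y≗ŷ Py)
          in ≤-trans (≤-reflexive (g-cong y≗ŷ))
               (All.lookup (Extrema.f[xs]≤f[argmax] totalOrder {f = g} z₀ candidates) ŷ∈)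

-- Intervals, rounded sizes and bounds on the harmonic function.

module Knapsack {c ℓ₁ ℓ₂} (R : RealField c ℓ₁ ℓ₂) (m : ℕ) (μ : RealField.Carrier R) where
  open RealField R hiding (zero)
  open Harmonic R
  open OrderedField R
  open RingIdentities commutativeRing

  -- As a successor, `k` lets `pred k` reduce to `m`.
  k : ℕ
  k = suc m

  -- `size i` and `bound i` are the ends of an interval. `gain i`, the coefficient in the integer
  -- objective, is what an item rounded down to `size i` earns beyond the rate `μ`.
  size bound gain : Vector Carrier m
  size  i = 1/ (suc (index i))
  bound i = 1/ (index i)
  gain  i = bound i - μ * size i

  index<k : ∀ (i : Fin m) → suc (index i) ℕ.≤ k
  index<k i = s≤s (toℕ<n i)

  0≤size : ∀ i → 0# ≤ size i
  0≤size i = <⇒≤ (0<1/ (suc (index i)))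

  gain+μ*size≈bound : ∀ i → gain i + μ * size i ≈ bound i
  gain+μ*size≈bound i = //-rightDividesˡ (μ * size i) (bound i)

  f-above : 0# ≤ μ → ∀ x → 0# ≤ x → (∃[ i ] size i < x × f k μ x ≤ bound i) ⊎ f k μ x ≤ μ * x
  f-above 0≤μ x 0≤x with any? {n = m} (λ i → inInterval? (index i) x)
  ... | yes (i , size<x , _) = inj₁ (i , size<x , ≤-refl)
  ... | no _ with (0# ≤? x) ×-dec (x ≤? 1/ k)
  ...   | yes _ = inj₂ ≤-refl
  -- Here `f` takes its default value `0#`, outside its domain; the rate `μ` still bounds it.
  ...   | no _  = inj₂ (*-nonNegative 0≤μ 0≤x)

  -- The search inside `f` may return some `j` instead of `i`. An index up to that of `i` earns at
  -- least `bound i`; a larger one would force `x ≤ size i`.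
  f-large : ∀ i x → size i < x → x ≤ bound i → bound i ≤ f k μ x
  f-large i x size<x x≤bound with any? {n = m} (λ i → inInterval? (index i) x)
  ... | no ∄i = contradiction (i , size<x , x≤bound) ∄i
  ... | yes (j , _ , x≤bound′) with index j ℕ.≤? index i
  ...   | yes j≤i = 1/-anti-≤ j≤i
  ...   | no  j≰i = contradiction (≤-trans x≤bound′ (1/-anti-≤ (ℕ.≰⇒> j≰i))) (<⇒≱ size<x)

  -- No interval starts below `1/ k`, because `suc (index i)` is at most `k`, so the search inside
  -- `f` fails.
  f-small : ∀ x → 0# ≤ x → x ≤ 1/ k → μ * x ≤ f k μ x
  f-small x 0≤x x≤1/k with any? {n = m} (λ i → inInterval? (index i) x)
  ... | yes (i , size<x , _) = contradiction (≤-trans x≤1/k (1/-anti-≤ (index<k i))) (<⇒≱ size<x)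
  ... | no _ with (0# ≤? x) ×-dec (x ≤? 1/ k)
  ...   | yes _ = ≤-refl
  ...   | no ¬p = contradiction (0≤x , x≤1/k) ¬p

  -- The integer program attains its maximum.

  feasible? : Decidable (FeasibleIP k)
  feasible? z = dot z size <? 1#

  feasible-resp : FeasibleIP k Respects _≗_
  feasible-resp {y} {z} y≗z <1 = begin-strict
    dot z size ≈⟨ dot-congˡ y≗z size ⟨
    dot y size <⟨ <1 ⟩
    1#         ∎

  -- Already `suc (index i)` items of size `size i` fill the knapsack, and this number is at most
  -- `k`. The uniform bound leaves finitely many candidates.
  feasible-bounded : ∀ z → FeasibleIP k z → ∀ i → z i ℕ.< suc k
  feasible-bounded z <1 i = ℕ.≰⇒> λ k<z → <⇒≱ <1 (begin
    1#                                 ≈⟨ fromℕ-*-1/ (suc (index i)) ⟨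
    fromℕ (suc (index i)) * size i     ≤⟨ *-monoˡ-≤ (0≤size i)
                                            (fromℕ-mono-≤ (ℕ.≤-trans (index<k i) (ℕ.<⇒≤ k<z))) ⟩
    fromℕ (z i) * size i               ≤⟨ term≤sum _ (dot-terms-nonNegative z size 0≤size) i ⟩
    dot z size                         ∎)

  empty-feasible : FeasibleIP k (λ _ → 0)
  empty-feasible = begin-strict dot (λ _ → 0) size ≈⟨ dot-0 size ⟩ 0# <⟨ 0<1 ⟩ 1# ∎

  optIP-exists : ∃[ z ] (FeasibleIP k z × ∀ y → FeasibleIP k y → objectiveIP k μ y ≤ objectiveIP k μ z)
  optIP-exists = argmax-exists (suc k) feasible? feasible-resp feasible-bounded (objectiveIP k μ)
    (λ y≗z → +-congˡ (dot-congˡ y≗z gain)) ((λ _ → 0) , empty-feasible)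

  -- Upper bound by rounding items down.

  -- The alternative dot z size ≈ 0# covers the case without large items, where
  -- nothing is rounded and the sum s may be zero.
  Rounding : Carrier → Carrier → Set _
  Rounding s t = ∃[ z ] (dot z size ≈ 0# ⊎ dot z size < s) × t ≤ μ * s + dot z gain

  -- Induction on the items: one charged at rate `μ` leaves `z` unchanged, one above `size i` adds
  -- one to `z i`. The first item counted makes the size bound strict, and nonnegative sizes keep it
  -- so.
  round : 0# ≤ μ → ∀ {n} (X : Vector Carrier n) → (∀ i → 0# ≤ X i) → Rounding (sum X) (sum (map (f k μ) X))
  round 0≤μ {zero} X 0≤X = (λ _ → 0) , inj₁ (dot-0 size) , ≤-reflexive (≈.sym (begin-equality
    μ * 0# + dot (λ _ → 0) gain ≈⟨ +-cong (zeroʳ μ) (dot-0 gain) ⟩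
    0# + 0#                     ≈⟨ +-identityˡ 0# ⟩
    0#                          ∎))
  round 0≤μ {suc n} X 0≤X with round 0≤μ (X ∘ suc) (0≤X ∘ suc) | f-above 0≤μ (X zero) (0≤X zero)
  ... | z , total , profit | inj₂ f≤μx = z , total′ total , (begin
    f k μ x + sum (map (f k μ) (X ∘ suc)) ≤⟨ +-mono-≤ f≤μx profit ⟩
    μ * x + (μ * s + dot z gain)          ≈⟨ regroup-small μ x s (dot z gain) ⟩
    μ * (x + s) + dot z gain              ∎)
    where
    x = X zero
    s = sum (X ∘ suc)
    total′ : dot z size ≈ 0# ⊎ dot z size < s → dot z size ≈ 0# ⊎ dot z size < x + s
    total′ (inj₁ ≈0) = inj₁ ≈0
    total′ (inj₂ <s) = inj₂ (begin-strict dot z size <⟨ <s ⟩ s ≤⟨ y≤x+y s (0≤X zero) ⟩ x + s ∎)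
  ... | z , total , profit | inj₁ (i , size<x , f≤bound) = updateAt z i suc , inj₂ total′ , (begin
    f k μ x + sum (map (f k μ) (X ∘ suc))           ≤⟨ +-mono-≤ f≤bound profit ⟩
    -- The profit splits into `gain i` and rate `μ` on the rounded size; charging that rate on the
    -- true size `x` only adds.
    bound i + (μ * s + dot z gain)                  ≈⟨ +-congʳ (gain+μ*size≈bound i) ⟨
    gain i + μ * size i + (μ * s + dot z gain)      ≤⟨ +-mono-≤ (+-monoʳ-≤ (gain i)
                                                         (*-monoʳ-≤ 0≤μ (<⇒≤ size<x))) ≤-refl ⟩
    gain i + μ * x + (μ * s + dot z gain)           ≈⟨ regroup-large (gain i) μ x s (dot z gain) ⟩
    μ * (x + s) + (gain i + dot z gain)             ≈⟨ +-congˡ (dot-increment z i gain) ⟨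
    μ * (x + s) + dot (updateAt z i suc) gain       ∎)
    where
    x = X zero
    s = sum (X ∘ suc)
    dot≤s : dot z size ≈ 0# ⊎ dot z size < s → dot z size ≤ s
    dot≤s (inj₁ ≈0) = ≤-trans (≤-reflexive ≈0) (sum-nonNegative (X ∘ suc) (0≤X ∘ suc))
    dot≤s (inj₂ <s) = <⇒≤ <s
    total′ : dot (updateAt z i suc) size < x + s
    total′ = begin-strict
      dot (updateAt z i suc) size ≈⟨ dot-increment z i size ⟩
      size i + dot z size         <⟨ +-mono-<-≤ size<x (dot≤s total) ⟩
      x + s                       ∎

  LP≤IP : 0# ≤ μ → ∀ {n} (X : Vector Carrier n) → FeasibleLP X →
          ∃[ z ] (FeasibleIP k z × sum (map (f k μ) X) ≤ objectiveIP k μ z)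
  LP≤IP 0≤μ X (0≤X , sum≤1) with round 0≤μ X 0≤X
  ... | z , total , profit = z , feasible total , (begin
    sum (map (f k μ) X)        ≤⟨ profit ⟩
    -- The constant `μ` of the objective is the rate `μ` on the full capacity `1#`.
    μ * sum X + dot z gain     ≤⟨ +-mono-≤ (*-monoʳ-≤ 0≤μ sum≤1) ≤-refl ⟩
    μ * 1# + dot z gain        ≈⟨ +-congʳ (*-identityʳ μ) ⟩
    objectiveIP k μ z          ∎)
    where
    feasible : dot z size ≈ 0# ⊎ dot z size < sum X → FeasibleIP k z
    feasible (inj₁ ≈0)   = begin-strict dot z size ≈⟨ ≈0 ⟩ 0# <⟨ 0<1 ⟩ 1# ∎
    feasible (inj₂ <sum) = begin-strict dot z size <⟨ <sum ⟩ sum X ≤⟨ sum≤1 ⟩ 1# ∎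

  -- Building packings item by item.

  -- Profits at least t from at least one item of total size at most s; the
  -- inequalities spare any transport of sums along ≈.
  record Packing (s t : Carrier) : Set (c ⊔ ℓ₂) where
    constructor packing
    field
      {pred-count} : ℕ
      items        : Vector Carrier (suc pred-count)
      nonNegative  : ∀ i → 0# ≤ items i
      fits         : sum items ≤ s
      earns        : t ≤ sum (map (f k μ) items)

  packing-resp : ∀ {s s′ t t′} → s ≤ s′ → t′ ≤ t → Packing s t → Packing s′ t′
  packing-resp s≤s′ t′≤t (packing X 0≤X sum≤s t≤sum) =
    packing X 0≤X (≤-trans sum≤s s≤s′) (≤-trans t′≤t t≤sum)

  -- A single item of size `0#`, since a packing has at least one item.
  packing-empty : Packing 0# 0#
  packing-empty = packing {pred-count = 0} (λ _ → 0#) (λ _ → ≤-refl) (≤-reflexive (+-identityˡ 0#)) (begin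
    0#              ≈⟨ zeroʳ μ ⟨
    μ * 0#          ≤⟨ f-small 0# ≤-refl (<⇒≤ (0<1/ k)) ⟩
    f k μ 0#        ≈⟨ +-identityʳ _ ⟨
    f k μ 0# + 0#   ∎)

  packing-item : ∀ {x y s t} → 0# ≤ x → y ≤ f k μ x → Packing s t → Packing (x + s) (y + t)
  packing-item {x} 0≤x y≤fx (packing X 0≤X sum≤s t≤sum) =
    packing
      (λ { zero → x ; (suc i) → X i })
      (λ { zero → 0≤x ; (suc i) → 0≤X i })
      (+-monoʳ-≤ x sum≤s)
      (+-mono-≤ y≤fx t≤sum)

  packing-copies : ∀ n {x y s t} → 0# ≤ x → y ≤ f k μ x → Packing s t →
                   Packing (fromℕ n * x + s) (fromℕ n * y + t)
  packing-copies zero {x} {y} {s} {t} 0≤x y≤fx =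
    packing-resp (≤-reflexive (≈.sym (vanish x s))) (≤-reflexive (vanish y t))
    where
    vanish : ∀ x s → 0# * x + s ≈ s
    vanish x s = ≈.trans (+-congʳ (zeroˡ x)) (+-identityˡ s)
  packing-copies (suc n) {x} {y} {s} {t} 0≤x y≤fx =
      packing-resp (≤-reflexive (≈.sym ([1+n]*x+s≈x+[n*x+s] x (fromℕ n) s)))
                   (≤-reflexive ([1+n]*x+s≈x+[n*x+s] y (fromℕ n) t))
    ∘ packing-item 0≤x y≤fx
    ∘ packing-copies n 0≤x y≤fx

  packing-dot : ∀ {n} (z : Vector ℕ n) x y {s t} → (∀ i → 0# ≤ x i) → (∀ i → y i ≤ f k μ (x i)) →
                Packing s t → Packing (dot z x + s) (dot z y + t)
  packing-dot {zero} z x y 0≤x y≤fx =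
    packing-resp (≤-reflexive (≈.sym (+-identityˡ _))) (≤-reflexive (+-identityˡ _))
  packing-dot {suc n} z x y 0≤x y≤fx =
      packing-resp (≤-reflexive (≈.sym (+-assoc _ _ _))) (≤-reflexive (+-assoc _ _ _))
    ∘ packing-copies (z zero) (0≤x zero) (y≤fx zero)
    ∘ packing-dot (z ∘ suc) (x ∘ suc) (y ∘ suc) (0≤x ∘ suc) (y≤fx ∘ suc)

  -- The amount `r` is split into `k` equal items. As `r ≤ 1#`, each is at most `1/ k`, where
  -- `f-small` gives the rate `μ`.
  packing-sand : ∀ {r s t} → 0# ≤ r → r ≤ 1# → Packing s t → Packing (r + s) (μ * r + t)
  packing-sand {r} {s} {t} 0≤r r≤1 =
      packing-resp (≤-reflexive (+-congʳ split)) (≤-reflexive (+-congʳ μ*split))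
    ∘ packing-copies k {x = r * 1/ k} {y = μ * (r * 1/ k)} 0≤r/k (f-small _ 0≤r/k r/k≤1/k)
    where
    0≤1/k : 0# ≤ 1/ k
    0≤1/k = <⇒≤ (0<1/ k)
    0≤r/k : 0# ≤ r * 1/ k
    0≤r/k = *-nonNegative 0≤r 0≤1/k
    r/k≤1/k : r * 1/ k ≤ 1/ k
    r/k≤1/k = ≤-trans (*-monoˡ-≤ 0≤1/k r≤1) (≤-reflexive (*-identityˡ _))
    split : fromℕ k * (r * 1/ k) ≈ r
    split = begin-equality
      fromℕ k * (r * 1/ k) ≈⟨ x*[y*z]≈y*[x*z] (fromℕ k) r _ ⟩
      r * (fromℕ k * 1/ k) ≈⟨ *-congˡ (fromℕ-*-1/ k) ⟩
      r * 1#               ≈⟨ *-identityʳ r ⟩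
      r                    ∎
    μ*split : μ * r ≈ fromℕ k * (μ * (r * 1/ k))
    μ*split = begin-equality
      μ * r                      ≈⟨ *-congˡ split ⟨
      μ * (fromℕ k * (r * 1/ k)) ≈⟨ x*[y*z]≈y*[x*z] μ (fromℕ k) _ ⟩
      fromℕ k * (μ * (r * 1/ k)) ∎

  -- Lower bound by perturbing an integer solution.

  module _ (z : Vector ℕ m) where

    private
      -- For the large items: their number, total unperturbed size, total gain and total profit.
      N A G T : Carrier
      N = dot z (λ _ → 1#)
      A = dot z size
      G = dot z gain
      T = dot z bound

      T≈G+μ*A : T ≈ G + μ * A
      T≈G+μ*A = ≈.trans (dot-congʳ z (≈.sym ∘ gain+μ*size≈bound)) (dot-linear z gain μ size)

      0≤N : 0# ≤ N
      0≤N = dot-nonNegative z _ (λ _ → <⇒≤ 0<1)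

    -- `δ≤gap` keeps each enlarged item within its interval; `N*δ≤slack` lets all of them fit
    -- together.
    module _ {δ} (0<δ : 0# < δ) (δ≤gap : ∀ i → δ ≤ bound i - size i)
             (N*δ≤slack : N * δ ≤ 1# - A) where

      private
        -- `r` is the capacity left for sand and `t` the resulting profit, whose `0#` comes from
        -- `packing-empty`.
        r t : Carrier
        r = 1# - (A + δ * N)
        t = T + (μ * r + 0#)

        -- The factor `1#` gives the shape of `dot-linear`, with the constant weights that define
        -- `N`.
        x : Vector Carrier m
        x i = size i + δ * 1#

        0<δ*1 : 0# < δ * 1#
        0<δ*1 = *-positive 0<δ 0<1

        dot≈ : dot z x ≈ A + δ * N
        dot≈ = dot-linear z size δ _

        0≤A+δ*N : 0# ≤ A + δ * N
        0≤A+δ*N = +-nonNegative (dot-nonNegative z size 0≤size) (*-nonNegative (<⇒≤ 0<δ) 0≤N)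

        0≤r : 0# ≤ r
        0≤r = x≤y⇒0≤y-x (begin
          A + δ * N    ≈⟨ +-congˡ (*-comm δ N) ⟩
          A + N * δ    ≤⟨ +-monoʳ-≤ A N*δ≤slack ⟩
          A + (1# - A) ≈⟨ x+[y-x]≈y A 1# ⟩
          1#           ∎)

        r≤1 : r ≤ 1#
        r≤1 = begin
          r               ≤⟨ y≤x+y r 0≤A+δ*N ⟩
          A + δ * N + r   ≈⟨ x+[y-x]≈y (A + δ * N) 1# ⟩
          1#              ∎

        x≤bound : ∀ i → x i ≤ bound i
        x≤bound i = begin
          size i + δ * 1#             ≈⟨ +-congˡ (*-identityʳ δ) ⟩
          size i + δ                  ≤⟨ +-monoʳ-≤ (size i) (δ≤gap i) ⟩
          size i + (bound i - size i) ≈⟨ x+[y-x]≈y (size i) (bound i) ⟩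
          bound i                     ∎

      packing-perturbed : Packing 1# t
      packing-perturbed =
        packing-resp (≤-reflexive full) ≤-refl
          (packing-dot z x bound
            (λ i → +-nonNegative (0≤size i) (<⇒≤ 0<δ*1))
            (λ i → f-large i (x i) (x<x+y (size i) 0<δ*1) (x≤bound i))
            (packing-sand 0≤r r≤1 packing-empty))
        where
        full : dot z x + (r + 0#) ≈ 1#
        full = begin-equality
          dot z x + (r + 0#) ≈⟨ +-cong dot≈ (+-identityʳ r) ⟩
          A + δ * N + r      ≈⟨ x+[y-x]≈y (A + δ * N) 1# ⟩
          1#                 ∎

      -- Enlarging the `N` large items by `δ` takes `N * δ` away from the sand, which earns at rate
      -- `μ`.
      objective≈loss+t : objectiveIP k μ z ≈ μ * N * δ + t
      objective≈loss+t = begin-equality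
        μ + G                                ≈⟨ +-congʳ (*-identityʳ μ) ⟨
        μ * 1# + G                           ≈⟨ +-congʳ (*-congˡ (x+[y-x]≈y (A + δ * N) 1#)) ⟨
        μ * (A + δ * N + r) + G              ≈⟨ regroup-perturbed μ A δ N r G ⟩
        μ * N * δ + (G + μ * A + μ * r)      ≈⟨ +-congˡ (+-cong T≈G+μ*A (+-identityʳ (μ * r))) ⟨
        μ * N * δ + t                        ∎

    IP≤LP : 0# ≤ μ → FeasibleIP k z → ∀ {ε} → 0# < ε → ∃[ t ] Packing 1# t × objectiveIP k μ z < ε + t
    IP≤LP 0≤μ A<1 {ε} 0<ε
      -- The three choices secure, in turn, the interval gaps, the slack in the constraint and a
      -- loss below `ε`; shrinking preserves the earlier conditions.
      with δ₀ , 0<δ₀ , δ₀≤gap ← lowerBound _ (λ i → x<y⇒0<y-x (1/-suc-< (index i)))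
      with δ₁ , 0<δ₁ , δ₁≤δ₀ , N*δ₁<slack ← shrink 0≤N (x<y⇒0<y-x A<1) 0<δ₀
      with δ , 0<δ , δ≤δ₁ , μ*N*δ<ε ← shrink (*-nonNegative 0≤μ 0≤N) 0<ε 0<δ₁ =
        _ , packing-perturbed 0<δ δ≤gap N*δ≤slack , (begin-strict
        objectiveIP k μ z ≈⟨ objective≈loss+t 0<δ δ≤gap N*δ≤slack ⟩
        μ * N * δ + _     <⟨ +-mono-<-≤ μ*N*δ<ε ≤-refl ⟩
        ε + _             ∎)
      where
      δ≤gap : ∀ i → δ ≤ bound i - size i
      δ≤gap i = ≤-trans δ≤δ₁ (≤-trans δ₁≤δ₀ (δ₀≤gap i))
      N*δ≤slack : N * δ ≤ 1# - A
      N*δ≤slack = ≤-trans (*-monoʳ-≤ 0≤N δ≤δ₁) (<⇒≤ N*δ₁<slack)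

  -- The common optimum.

  module _ (0≤μ : 0# ≤ μ) (z : Vector ℕ m) (Fz : FeasibleIP k z)
           (optimal : ∀ y → FeasibleIP k y → objectiveIP k μ y ≤ objectiveIP k μ z) where

    optIP : IsOptIP k μ (objectiveIP k μ z)
    optIP = (z , Fz , ≈.refl) , λ { s (y , Fy , s≈) → ≤-trans (≤-reflexive s≈) (optimal y Fy) }

    LPValue-bounded : ∀ n → IsUpperBound (LPValue k μ n) (objectiveIP k μ z)
    LPValue-bounded n s (X , feasible , s≈) =
      let y , Fy , profit≤ = LP≤IP 0≤μ X feasible
      in ≤-trans (≤-reflexive s≈) (≤-trans profit≤ (optimal y Fy))

    LPOptimum : Pred Carrier _
    LPOptimum s = ∃[ n ] NonZero n × IsSupremum (LPValue k μ n) s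

    -- `u` bounds only the suprema for fixed numbers of items, so `complete` supplies the one for
    -- this packing, with the integer optimum as the required upper bound.
    packing≤ : ∀ {t u} → IsUpperBound LPOptimum u → Packing 1# t → t ≤ u
    packing≤ u-bounds (packing {n} X 0≤X sum≤1 t≤sum) =
      let value   = sum (map (f k μ) X)
          isValue = X , (0≤X , sum≤1) , ≈.refl
          s , s-bounds , s-least =
            complete (LPValue k μ (suc n)) (value , isValue)
                     (objectiveIP k μ z , LPValue-bounded (suc n))
      in ≤-trans t≤sum (≤-trans (s-bounds value isValue) (u-bounds s (suc n , _ , s-bounds , s-least)))

    optLP : IsOptLP k μ (objectiveIP k μ z)
    optLP = (λ { s (n , _ , _ , s-least) → s-least (objectiveIP k μ z) (LPValue-bounded n) }) , least
      where
      least : ∀ u → IsUpperBound LPOptimum u → objectiveIP k μ z ≤ u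
      least u u-bounds = decidable-stable (v ≤? u) λ v≰u →
        -- With `v - u` as `ε`, the packing would earn more than `u`.
        let t , P , v<ε+t = IP≤LP z 0≤μ Fz (x<y⇒0<y-x (≰⇒> v≰u))
        in <⇒≱ v<ε+t (begin
             v - u + t ≤⟨ +-monoʳ-≤ (v - u) (packing≤ u-bounds P) ⟩
             v - u + u ≈⟨ //-rightDividesˡ u v ⟩
             v         ∎)
        where v = objectiveIP k μ z

theorem1 : ∀ {c ℓ₁ ℓ₂} (R : RealField c ℓ₁ ℓ₂) →
    let open RealField R
        open Harmonic R
    in ∀ (k : ℕ) .{{_ : NonZero k}} (μ : Carrier) → 0# ≤ μ → μ ≤ fromℕ k →
       ∃[ v ] (IsOptLP k μ v × IsOptIP k μ v)
theorem1 R zero    μ 0≤μ _ = contradiction ≡.refl (ℕ.≢-nonZero⁻¹ 0)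
theorem1 R (suc m) μ 0≤μ _ =
  let open Knapsack R m μ
      z , Fz , optimal = optIP-exists
  in Harmonic.objectiveIP R (suc m) μ z , optLP 0≤μ z Fz optimal , optIP 0≤μ z Fz optimal
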